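{- Let $P(x)=x^4+k_2x^2+k_3x+k_4$ be a real polynomial with $P(x)\neq x^4$. If $P(x)$ is not of the form $x^4+k_2x^2+\left(\frac{k_2}{2}\right)^2$ with $k_2<0$, then $P(x)$ is $\mathcal{R}$ if and only if $P(x)$ is $\mathcal{IR}$. If $P(x)=x^4+k_2x^2+\left(\frac{k_2}{2}\right)^2$ with $k_2<0$, then $P(x)$ is not $\mathcal{IR}$.
   Context: A monic real polynomial $P(x)$ of degree $n$ is realizable ($\mathcal{R}$) if it is the characteristic polynomial of some $n\times n$ entrywise nonnegative matrix; it is irreducibly realizable ($\mathcal{IR}$) if it is the characteristic polynomial of some $n\times n$ irreducible entrywise nonnegative matrix. A square matrix is irreducible if it is not similar by a permutation matrix to a nontrivially block triangular matrix (equivalently, its digraph is strongly connected). -}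

module Defs where

open import Algebra.Bundles using (CommutativeRing)
open import Algebra.Bundles.Raw using (RawRing)
import Algebra.Definitions.RawMonoid as RawMonoidDefs
import Algebra.Definitions.RawSemiring as RawSemiringDefs
open import Data.Bool.Base using (if_then_else_)
open import Data.Fin.Base using (Fin; zero; suc; toℕ; punchIn)
open import Data.Fin.Permutation using (Permutation′; _⟨$⟩ʳ_)
open import Data.Fin.Properties using (_≟_)
open import Data.List.Base using (List; []; _∷_; map)
open import Data.Nat.Base as ℕ using (ℕ; zero; suc)
open import Data.Product.Base using (∃; Σ-syntax; ∃-syntax; _×_)
open import Level using (Level; _⊔_) renaming (suc to lsuc)
import Relation.Binary.Construct.NonStrictToStrict as ToStrict
open import Relation.Binary.Core using (Rel)
open import Relation.Binary.Structures using (IsDecTotalOrder)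
open import Relation.Nullary.Decidable.Core using (does)
open import Relation.Nullary.Negation.Core using (¬_)
open import Relation.Unary using (Pred)

-- The real numbers, characterised (classically, up to unique isomorphism) as
-- a Dedekind-complete ordered field.  The order is decidable and _⁻¹ is total,
-- with an unspecified value at zero: this is the classical theory of ℝ, so a
-- model requires classical principles in the metatheory.
record CompleteOrderedField (c ℓ₁ ℓ₂ : Level) : Set (lsuc (c ⊔ ℓ₁ ⊔ ℓ₂)) where
  field
    commutativeRing : CommutativeRing c ℓ₁

  open CommutativeRing commutativeRing public

  infix  4 _≤_
  infix  8 _⁻¹
  infixl 7 _/_

  field
    1≉0             : 1# ≉ 0#
    _⁻¹             : Carrier → Carrier
    ⁻¹-cong         : ∀ {x y} → x ≈ y → x ⁻¹ ≈ y ⁻¹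
    *-inverseʳ      : ∀ x → x ≉ 0# → x * x ⁻¹ ≈ 1#
    _≤_             : Rel Carrier ℓ₂
    isDecTotalOrder : IsDecTotalOrder _≈_ _≤_
    +-monoˡ-≤       : ∀ z {x y} → x ≤ y → x + z ≤ y + z
    *-nonNegative   : ∀ {x y} → 0# ≤ x → 0# ≤ y → 0# ≤ x * y

  IsUpperBound : ∀ {ℓ} → Pred Carrier ℓ → Pred Carrier (c ⊔ ℓ₂ ⊔ ℓ)
  IsUpperBound S u = ∀ x → S x → x ≤ u

  field
    supremum : (S : Pred Carrier (c ⊔ ℓ₁ ⊔ ℓ₂)) → ∃ S → ∃ (IsUpperBound S) →
               ∃[ s ] IsUpperBound S s × (∀ u → IsUpperBound S u → s ≤ u)

  open ToStrict _≈_ _≤_ public using (_<_)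

  _/_ : Carrier → Carrier → Carrier
  x / y = x * y ⁻¹

Matrix : ∀ {a} → Set a → ℕ → Set a
Matrix A n = Fin n → Fin n → A

module Determinant {c ℓ} (R : RawRing c ℓ) where
  open RawRing R
  open RawMonoidDefs +-rawMonoid using (sum)
  open RawSemiringDefs rawSemiring using (_^_)

  -- Laplace expansion along the first row.
  det : ∀ {n} → Matrix Carrier n → Carrier
  det {zero}  M = 1#
  det {suc n} M = sum λ j →
    (- 1#) ^ toℕ j * (M zero j * det (λ i k → M (suc i) (punchIn j k)))

-- A polynomial is its list of coefficients, constant term first.  Trailing
-- zeros are permitted, so polynomials are compared coefficientwise.
module Polynomial {c ℓ} (R : RawRing c ℓ) where
  open RawRing R

  Poly : Set c
  Poly = List Carrier

  coeff : Poly → ℕ → Carrier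
  coeff []      _       = 0#
  coeff (a ∷ p) zero    = a
  coeff (a ∷ p) (suc i) = coeff p i

  infix  4 _≈ᵖ_
  infixl 6 _+ᵖ_
  infixl 7 _*ᵖ_
  infix  8 -ᵖ_

  _≈ᵖ_ : Rel Poly ℓ
  p ≈ᵖ q = ∀ i → coeff p i ≈ coeff q i

  _+ᵖ_ : Poly → Poly → Poly
  []      +ᵖ q       = q
  (a ∷ p) +ᵖ []      = a ∷ p
  (a ∷ p) +ᵖ (b ∷ q) = (a + b) ∷ (p +ᵖ q)

  -ᵖ_ : Poly → Poly
  -ᵖ_ = map -_

  _*ᵖ_ : Poly → Poly → Poly
  []      *ᵖ q = []
  (a ∷ p) *ᵖ q = map (a *_) q +ᵖ (0# ∷ (p *ᵖ q))

  const : Carrier → Poly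
  const a = a ∷ []

  X : Poly
  X = 0# ∷ 1# ∷ []

  polyRawRing : RawRing c ℓ
  polyRawRing = record
    { Carrier = Poly
    ; _≈_     = _≈ᵖ_
    ; _+_     = _+ᵖ_
    ; _*_     = _*ᵖ_
    ; -_      = -ᵖ_
    ; 0#      = []
    ; 1#      = const 1#
    }

module Realizability {c ℓ₁ ℓ₂} (ℝ : CompleteOrderedField c ℓ₁ ℓ₂) where
  open CompleteOrderedField ℝ public

  open Polynomial rawRing public
  open Determinant polyRawRing using (det)

  -- det (xI − A)
  charPoly : ∀ {n} → Matrix Carrier n → Poly
  charPoly A = det λ i j → (if does (i ≟ j) then X else []) +ᵖ -ᵖ const (A i j)

  NonNegative : ∀ {n} → Matrix Carrier n → Set ℓ₂
  NonNegative A = ∀ i j → 0# ≤ A i j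

  -- Both diagonal blocks, of sizes k and n − k, are nonempty.
  BlockTriangular : ∀ {n} → Matrix Carrier n → Set ℓ₁
  BlockTriangular {n} A =
    ∃[ k ] 0 ℕ.< k × k ℕ.< n ×
           (∀ i j → k ℕ.≤ toℕ i → toℕ j ℕ.< k → A i j ≈ 0#)

  -- Conjugating by a permutation matrix permutes rows and columns
  -- simultaneously.
  Irreducible : ∀ {n} → Matrix Carrier n → Set ℓ₁
  Irreducible {n} A =
    ¬ (Σ[ π ∈ Permutation′ n ]
         BlockTriangular (λ i j → A (π ⟨$⟩ʳ i) (π ⟨$⟩ʳ j)))

  -- Since a characteristic polynomial of an n × n matrix is monic of degree n,
  -- these force P to be so.
  Realizable : ℕ → Poly → Set (c ⊔ ℓ₁ ⊔ ℓ₂)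
  Realizable n P = Σ[ A ∈ Matrix Carrier n ] NonNegative A × charPoly A ≈ᵖ P

  IrreduciblyRealizable : ℕ → Poly → Set (c ⊔ ℓ₁ ⊔ ℓ₂)
  IrreduciblyRealizable n P =
    Σ[ A ∈ Matrix Carrier n ] NonNegative A × Irreducible A × charPoly A ≈ᵖ P

  -- x⁴ + k₂x² + k₃x + k₄
  quartic : Carrier → Carrier → Carrier → Poly
  quartic k₂ k₃ k₄ = k₄ ∷ k₃ ∷ k₂ ∷ 0# ∷ 1# ∷ []

  2# : Carrier
  2# = 1# + 1#

{-# OPTIONS --safe #-}

-- Write a, b, c, d, e, f for the weights of the 2-cycles 01, 23, 02, 13, 03, 12
-- of a nonnegative matrix with zero trace, hence zero diagonal.  Then −k₂ and
-- −k₃ are the total weights of the 2-cycles and 3-cycles, and k₄ is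
-- ab + cd + ef minus the total weight of the 4-cycles.  The 4-cycles come in
-- three pairs of mutually reverse ones, with products of weights ab·cd, ab·ef
-- and cd·ef.  If ab is the largest of ab, cd, ef, the first two pairs weigh at
-- least cd and ef, so that k₄ ≤ ab ≤ (k₂/2)².  In case of equality with k₂ < 0,
-- only the 2-cycles 01 and 23 survive and every cycle through both {0,1} and
-- {2,3} vanishes, so the matrix is reducible.
--
-- Conversely k₂ ≤ 0, k₃ ≤ 0 and k₄ ≤ (k₂/2)² suffice for a realisation: take
-- the path 0 → 1 → 2 → 3 with edges of weight 1 and add weighted returning
-- edges.  Both 2-cycles get weight −k₂/2 and a 4-cycle of weight (k₂/2)² − k₄
-- corrects k₄, which avoids taking square roots.
module Submission where

open import Defs
open import Algebra.Bundles using (CommutativeRing)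
open import Algebra.Bundles.Raw using (RawRing)
import Algebra.Properties.Ring as RingProperties
import Algebra.Properties.Semiring.Exp as Exp
import Algebra.Properties.Semiring.Mult.TCOptimised as Mult
import Algebra.Solver.Ring as RingSolver
open import Algebra.Solver.Ring.AlmostCommutativeRing
  using (fromCommutativeRing; _-Raw-AlmostCommutative⟶_)
open import Data.Bool.Base using (if_then_else_)
open import Data.Empty using (⊥)
open import Data.Fin.Base using (Fin; toℕ; fromℕ<; combine; remQuot; _↑ˡ_; _↑ʳ_)
open import Data.Fin.Patterns
open import Data.Fin.Permutation
  using (Permutation′; _⟨$⟩ʳ_; _⟨$⟩ˡ_; inverseˡ; inverseʳ; _∘ₚ_; transpose; reverse)
  renaming (id to idₚ)
open import Data.Fin.Properties using (_≟_; toℕ-fromℕ<)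
open import Data.Integer.Base as ℤ using (ℤ; -[1+_]; _⊖_) renaming (+_ to pos)
import Data.Integer.Properties as ℤₚ
open import Data.List.Base using (List; []; _∷_; foldr)
open import Data.List.Relation.Unary.All as All using (All; []; _∷_)
open import Data.Maybe.Base using (just; nothing)
open import Data.Nat.Base as ℕ using (ℕ; zero; suc; z≤n; s≤s)
import Data.Nat.Properties as ℕₚ
open import Data.Product.Base using (Σ-syntax; _×_; _,_; proj₁; proj₂; uncurry)
open import Data.Sum.Base using (_⊎_; inj₁; inj₂)
open import Data.Vec.Base using ([]; _∷_; lookup; tabulate)
open import Data.Vec.Properties using (lookup∘tabulate)
open import Function.Base using (_∘_)
open import Function.Bundles using (_⇔_; mk⇔)
open import Level using (Level; 0ℓ)
open import Relation.Binary.Definitions using (WeaklyDecidable)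
open import Relation.Binary.PropositionalEquality.Core as ≡ using (_≡_)
import Relation.Binary.Reasoning.Setoid as SetoidReasoning
open import Relation.Binary.Structures using (IsDecTotalOrder)
open import Relation.Nullary.Decidable.Core using (Dec; does; yes; no; decidable-stable)
open import Relation.Nullary.Negation.Core using (¬_)
open import Relation.Unary using (Pred)

-- Ring solver with integer coefficients.

-- The solver cancels coefficients by computation, which ℤ allows and an abstract
-- ring does not.
module IntegerCoefficients {c ℓ} (R : CommutativeRing c ℓ) where
  open CommutativeRing R
  open RingProperties ring
  open Mult semiring using (×-homo-+; ×1-homo-*) renaming (_×_ to _·_)
  open SetoidReasoning setoid

  fromℤ : ℤ → Carrier
  fromℤ (pos n)  = n · 1#
  fromℤ -[1+ n ] = - (suc n · 1#)

  fromℤ-⊖ : ∀ m n → fromℤ (m ⊖ n) ≈ m · 1# - n · 1#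
  fromℤ-⊖ m       zero    = sym (trans (+-congˡ -0#≈0#) (+-identityʳ _))
  fromℤ-⊖ zero    (suc n) = sym (+-identityˡ _)
  fromℤ-⊖ (suc m) (suc n) = begin
    fromℤ (suc m ⊖ suc n)                  ≡⟨ ≡.cong fromℤ (ℤₚ.[1+m]⊖[1+n]≡m⊖n m n) ⟩
    fromℤ (m ⊖ n)                          ≈⟨ fromℤ-⊖ m n ⟩
    m · 1# - n · 1#                        ≈⟨ +-congʳ (+-identityˡ _) ⟨
    (0# + m · 1#) - n · 1#                 ≈⟨ +-congʳ (+-congʳ (-‿inverseʳ 1#)) ⟨
    (1# - 1# + m · 1#) - n · 1#            ≈⟨ +-congʳ (trans (+-congʳ (+-comm _ _)) (+-assoc _ _ _)) ⟩
    (- 1# + (1# + m · 1#)) - n · 1#        ≈⟨ +-congʳ (+-comm _ _) ⟩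
    (1# + m · 1#) - 1# - n · 1#            ≈⟨ +-assoc _ _ _ ⟩
    (1# + m · 1#) + (- 1# - n · 1#)        ≈⟨ +-congˡ (-‿+-comm _ _) ⟩
    (1# + m · 1#) - (1# + n · 1#)          ≈⟨ +-cong (×-homo-+ 1# 1 m) (-‿cong (×-homo-+ 1# 1 n)) ⟨
    suc m · 1# - suc n · 1#                ∎

  fromℤ-+ : ∀ i j → fromℤ (i ℤ.+ j) ≈ fromℤ i + fromℤ j
  fromℤ-+ (pos m)  (pos n)  = ×-homo-+ 1# m n
  fromℤ-+ (pos m)  -[1+ n ] = fromℤ-⊖ m (suc n)
  fromℤ-+ -[1+ m ] (pos n)  = trans (fromℤ-⊖ n (suc m)) (+-comm _ _)
  fromℤ-+ -[1+ m ] -[1+ n ] = begin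
    - (suc (suc (m ℕ.+ n)) · 1#)       ≡⟨ ≡.cong (λ k → - (k · 1#)) (≡.cong suc (≡.sym (ℕₚ.+-suc m n))) ⟩
    - ((suc m ℕ.+ suc n) · 1#)         ≈⟨ -‿cong (×-homo-+ 1# (suc m) (suc n)) ⟩
    - (suc m · 1# + suc n · 1#)        ≈⟨ -‿+-comm _ _ ⟨
    - (suc m · 1#) - suc n · 1#        ∎

  fromℤ-‿ : ∀ i → fromℤ (ℤ.- i) ≈ - fromℤ i
  fromℤ-‿ (pos zero)    = sym -0#≈0#
  fromℤ-‿ (pos (suc n)) = refl
  fromℤ-‿ -[1+ n ]      = sym (-‿involutive _)

  fromℤ-*⁺ : ∀ m j → fromℤ (pos m ℤ.* j) ≈ fromℤ (pos m) * fromℤ j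
  fromℤ-*⁺ m (pos n)  = trans (reflexive (≡.cong fromℤ (≡.sym (ℤₚ.pos-* m n)))) (×1-homo-* m n)
  fromℤ-*⁺ m -[1+ n ] = begin
    fromℤ (pos m ℤ.* ℤ.- pos (suc n))    ≡⟨ ≡.cong fromℤ (ℤₚ.neg-distribʳ-* (pos m) (pos (suc n))) ⟨
    fromℤ (ℤ.- (pos m ℤ.* pos (suc n)))  ≈⟨ fromℤ-‿ (pos m ℤ.* pos (suc n)) ⟩
    - fromℤ (pos m ℤ.* pos (suc n))      ≈⟨ -‿cong (fromℤ-*⁺ m (pos (suc n))) ⟩
    - (m · 1# * (suc n · 1#))            ≈⟨ -‿distribʳ-* _ _ ⟩
    m · 1# * - (suc n · 1#)              ∎

  fromℤ-* : ∀ i j → fromℤ (i ℤ.* j) ≈ fromℤ i * fromℤ j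
  fromℤ-* (pos m)  j = fromℤ-*⁺ m j
  fromℤ-* -[1+ m ] j = begin
    fromℤ (ℤ.- pos (suc m) ℤ.* j)    ≡⟨ ≡.cong fromℤ (ℤₚ.neg-distribˡ-* (pos (suc m)) j) ⟨
    fromℤ (ℤ.- (pos (suc m) ℤ.* j))  ≈⟨ fromℤ-‿ (pos (suc m) ℤ.* j) ⟩
    - fromℤ (pos (suc m) ℤ.* j)      ≈⟨ -‿cong (fromℤ-*⁺ (suc m) j) ⟩
    - (suc m · 1# * fromℤ j)         ≈⟨ -‿distribˡ-* _ _ ⟩
    - (suc m · 1#) * fromℤ j         ∎

  morphism : ℤ.+-*-rawRing -Raw-AlmostCommutative⟶ fromCommutativeRing R
  morphism = record
    { ⟦_⟧    = fromℤ
    ; +-homo = fromℤ-+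
    ; *-homo = fromℤ-*
    ; -‿homo = fromℤ-‿
    ; 0-homo = refl
    ; 1-homo = refl
    }

  fromℤ-≟ : WeaklyDecidable (λ i j → fromℤ i ≈ fromℤ j)
  fromℤ-≟ i j with i ℤₚ.≟ j
  ... | yes i≡j = just (reflexive (≡.cong fromℤ i≡j))
  ... | no  _   = nothing

  open RingSolver ℤ.+-*-rawRing (fromCommutativeRing R) morphism fromℤ-≟ public

  -- Polynomials and determinants are defined over any raw ring, so instantiating
  -- them here yields reified expressions whose meaning is the original by
  -- computation.
  expressions : ℕ → RawRing _ _
  expressions n = record
    { Carrier = Polynomial n
    ; _≈_     = _≡_
    ; _+_     = _:+_
    ; _*_     = _:*_
    ; -_      = :-_
    ; 0#      = con (pos 0)
    ; 1#      = con (pos 1)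
    }

  -- Lets matrix entries be replaced by equal ones inside a reified determinant, so that no
  -- congruence proof for `det` is required.
  ⟦⟧-cong : ∀ {n} (e : Polynomial n) {ρ ρ′ : Env n} →
            (∀ i → lookup ρ i ≈ lookup ρ′ i) → ⟦ e ⟧ ρ ≈ ⟦ e ⟧ ρ′
  ⟦⟧-cong (op [+] e e′) ρ≈ρ′ = +-cong (⟦⟧-cong e ρ≈ρ′) (⟦⟧-cong e′ ρ≈ρ′)
  ⟦⟧-cong (op [*] e e′) ρ≈ρ′ = *-cong (⟦⟧-cong e ρ≈ρ′) (⟦⟧-cong e′ ρ≈ρ′)
  ⟦⟧-cong (con c)       ρ≈ρ′ = refl
  ⟦⟧-cong (var i)       ρ≈ρ′ = ρ≈ρ′ i
  ⟦⟧-cong (e :^ k)      ρ≈ρ′ = Exp.^-congˡ semiring k (⟦⟧-cong e ρ≈ρ′)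
  ⟦⟧-cong (:- e)        ρ≈ρ′ = -‿cong (⟦⟧-cong e ρ≈ρ′)

-- Characteristic polynomials, cycle weights and witness matrices over a raw ring.

module CharPoly {c ℓ} (R : RawRing c ℓ) where
  open RawRing R
  open Polynomial R public
  open Determinant polyRawRing using (det)

  -- The formula of `Realizability`, over an arbitrary raw ring so that it can be evaluated on
  -- solver expressions.
  charPoly : ∀ {n} → Matrix Carrier n → Poly
  charPoly A = det λ i j → (if does (i ≟ j) then X else []) +ᵖ -ᵖ const (A i j)

module Cycles {c ℓ} (R : RawRing c ℓ) where
  open RawRing R

  total : List Carrier → Carrier
  total = foldr _+_ 0#

  module _ (A : Matrix Carrier 4) where

    c₂ : Fin 4 → Fin 4 → Carrier
    c₂ i j = A i j * A j i

    c₃ : Fin 4 → Fin 4 → Fin 4 → Carrier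
    c₃ i j k = A i j * A j k * A k i

    c₄ : Fin 4 → Fin 4 → Fin 4 → Fin 4 → Carrier
    c₄ i j k l = A i j * A j k * A k l * A l i

    -- Each triangle starts with its only edge from {0,1} to {2,3}; mutually
    -- reverse squares are adjacent.
    diagonal pairs triangles matchings squares : List Carrier
    diagonal  = A 0F 0F ∷ A 1F 1F ∷ A 2F 2F ∷ A 3F 3F ∷ []
    pairs     = c₂ 0F 1F ∷ c₂ 2F 3F ∷ c₂ 0F 2F ∷ c₂ 1F 3F ∷ c₂ 0F 3F ∷ c₂ 1F 2F ∷ []
    triangles = c₃ 0F 2F 3F ∷ c₃ 0F 3F 2F ∷ c₃ 1F 2F 3F ∷ c₃ 1F 3F 2F ∷
                c₃ 0F 2F 1F ∷ c₃ 0F 3F 1F ∷ c₃ 1F 2F 0F ∷ c₃ 1F 3F 0F ∷ []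
    matchings = c₂ 0F 1F * c₂ 2F 3F ∷ c₂ 0F 2F * c₂ 1F 3F ∷ c₂ 0F 3F * c₂ 1F 2F ∷ []
    squares   = c₄ 0F 2F 3F 1F ∷ c₄ 1F 3F 2F 0F ∷ c₄ 0F 3F 2F 1F ∷ c₄ 1F 2F 3F 0F ∷
                c₄ 0F 2F 1F 3F ∷ c₄ 0F 3F 1F 2F ∷ []

module Witnesses {c ℓ} (R : RawRing c ℓ) where
  open RawRing R

  -- The edges of weight m, r, q close cycles of lengths 2 (twice), 3 and 4.
  cyclic : Carrier → Carrier → Carrier → Matrix Carrier 4
  cyclic m r q i j = lookup (lookup rows i) j
    where
    rows = (0# ∷ 1# ∷ 0# ∷ 0# ∷ []) ∷
           (m  ∷ 0# ∷ 1# ∷ 0# ∷ []) ∷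
           (r  ∷ 0# ∷ 0# ∷ 1# ∷ []) ∷
           (q  ∷ 0# ∷ m  ∷ 0# ∷ []) ∷ []

  -- For k₂ = k₄ = 0, where cyclic is reducible: two 3-cycles sharing the edge
  -- 0 → 1, and no other cycle.
  forked : Carrier → Matrix Carrier 4
  forked r i j = lookup (lookup rows i) j
    where
    rows = (0# ∷ 1# ∷ 0# ∷ 0# ∷ []) ∷
           (0# ∷ 0# ∷ 1# ∷ 1# ∷ []) ∷
           (r  ∷ 0# ∷ 0# ∷ 0# ∷ []) ∷
           (r  ∷ 0# ∷ 0# ∷ 0# ∷ []) ∷ []

-- Ordered-field inequalities.

module OrderedFieldProperties {c ℓ₁ ℓ₂} (ℝ : CompleteOrderedField c ℓ₁ ℓ₂) where
  open Realizability ℝ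
  open IntegerCoefficients commutativeRing
  open Cycles rawRing using (total)
  open RingProperties ring public using (-0#≈0#; -‿involutive)
  module ≤ = IsDecTotalOrder isDecTotalOrder

  x≤y⇒0≤y-x : ∀ {x y} → x ≤ y → 0# ≤ y - x
  x≤y⇒0≤y-x {x} x≤y = ≤.≤-respˡ-≈ (-‿inverseʳ x) (+-monoˡ-≤ (- x) x≤y)

  0≤y-x⇒x≤y : ∀ {x y} → 0# ≤ y - x → x ≤ y
  0≤y-x⇒x≤y {x} {y} 0≤y-x =
    ≤.≤-respˡ-≈ (+-identityˡ x) (≤.≤-respʳ-≈ y-x+x≈y (+-monoˡ-≤ x 0≤y-x))
    where
    y-x+x≈y : y - x + x ≈ y
    y-x+x≈y = solve 2 (λ x y → y :- x :+ x := y) refl x y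

  x≤0⇒0≤-x : ∀ {x} → x ≤ 0# → 0# ≤ - x
  x≤0⇒0≤-x x≤0 = ≤.≤-respʳ-≈ (+-identityˡ _) (x≤y⇒0≤y-x x≤0)

  -x≈y⇒y≤0 : ∀ {x y} → 0# ≤ x → - x ≈ y → y ≤ 0#
  -x≈y⇒y≤0 {x} 0≤x -x≈y = ≤.≤-respˡ-≈ -x≈y
    (0≤y-x⇒x≤y (≤.≤-respʳ-≈ (solve 1 (λ x → x := con (pos 0) :- (:- x)) refl x) 0≤x))

  +-nonNegative : ∀ {x y} → 0# ≤ x → 0# ≤ y → 0# ≤ x + y
  +-nonNegative {x} {y} 0≤x 0≤y =
    ≤.trans 0≤y (≤.≤-respˡ-≈ (+-identityˡ y) (+-monoˡ-≤ y 0≤x))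

  0≤x² : ∀ x → 0# ≤ x * x
  0≤x² x with ≤.total 0# x
  ... | inj₁ 0≤x = *-nonNegative 0≤x 0≤x
  ... | inj₂ x≤0 = ≤.≤-respʳ-≈ (solve 1 (λ x → (:- x) :* (:- x) := x :* x) refl x)
    (*-nonNegative (x≤0⇒0≤-x x≤0) (x≤0⇒0≤-x x≤0))

  0≤1 : 0# ≤ 1#
  0≤1 = ≤.≤-respʳ-≈ (*-identityʳ 1#) (0≤x² 1#)

  0≤2 : 0# ≤ 2#
  0≤2 = +-nonNegative 0≤1 0≤1

  x+y≈0⇒x≈0 : ∀ {x y} → 0# ≤ x → 0# ≤ y → x + y ≈ 0# → x ≈ 0#
  x+y≈0⇒x≈0 {x} {y} 0≤x 0≤y x+y≈0 = ≤.antisym (-x≈y⇒y≤0 0≤y -y≈x) 0≤x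
    where
    -y≈x : - y ≈ x
    -y≈x = trans (trans (sym (+-identityˡ _)) (+-congʳ (sym x+y≈0)))
      (solve 2 (λ x y → x :+ y :- y := x) refl x y)

  x+y≈0⇒y≈0 : ∀ {x y} → 0# ≤ x → 0# ≤ y → x + y ≈ 0# → y ≈ 0#
  x+y≈0⇒y≈0 0≤x 0≤y x+y≈0 = x+y≈0⇒x≈0 0≤y 0≤x (trans (+-comm _ _) x+y≈0)

  total-nonNegative : ∀ {xs} → All (0# ≤_) xs → 0# ≤ total xs
  total-nonNegative []            = ≤.refl
  total-nonNegative (0≤x ∷ 0≤xs) = +-nonNegative 0≤x (total-nonNegative 0≤xs)

  total≈0⇒all≈0 : ∀ {xs} → All (0# ≤_) xs → total xs ≈ 0# → All (_≈ 0#) xs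
  total≈0⇒all≈0 []            _     = []
  total≈0⇒all≈0 (0≤x ∷ 0≤xs) Σ≈0 =
    x+y≈0⇒x≈0 0≤x (total-nonNegative 0≤xs) Σ≈0 ∷
    total≈0⇒all≈0 0≤xs (x+y≈0⇒y≈0 0≤x (total-nonNegative 0≤xs) Σ≈0)

  x≉0∧xy≈0⇒y≈0 : ∀ {x y} → x ≉ 0# → x * y ≈ 0# → y ≈ 0#
  x≉0∧xy≈0⇒y≈0 {x} {y} x≉0 xy≈0 = begin
    y               ≈⟨ *-identityˡ y ⟨
    1# * y          ≈⟨ *-congʳ (*-inverseʳ x x≉0) ⟨
    x * x ⁻¹ * y    ≈⟨ solve 3 (λ x h y → x :* h :* y := h :* (x :* y)) refl x (x ⁻¹) y ⟩
    x ⁻¹ * (x * y)  ≈⟨ *-congˡ xy≈0 ⟩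
    x ⁻¹ * 0#       ≈⟨ zeroʳ _ ⟩
    0#              ∎
    where open SetoidReasoning setoid

  infixl 7 _*-≉0_
  _*-≉0_ : ∀ {x y} → x ≉ 0# → y ≉ 0# → x * y ≉ 0#
  (x≉0 *-≉0 y≉0) xy≈0 = y≉0 (x≉0∧xy≈0⇒y≈0 x≉0 xy≈0)

  x²≈0⇒x≈0 : ∀ {x} → x * x ≈ 0# → x ≈ 0#
  x²≈0⇒x≈0 {x} x²≈0 = decidable-stable (x ≤.≟ 0#) λ x≉0 → (x≉0 *-≉0 x≉0) x²≈0

  xy≉0⇒x≉0 : ∀ {x y} → x * y ≉ 0# → x ≉ 0#
  xy≉0⇒x≉0 xy≉0 x≈0 = xy≉0 (trans (*-congʳ x≈0) (zeroˡ _))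

  xy≉0⇒y≉0 : ∀ {x y} → x * y ≉ 0# → y ≉ 0#
  xy≉0⇒y≉0 xy≉0 y≈0 = xy≉0 (trans (*-congˡ y≈0) (zeroʳ _))

  x-y≈0⇒x≈y : ∀ {x y} → x - y ≈ 0# → x ≈ y
  x-y≈0⇒x≈y {x} {y} x-y≈0 = trans (solve 2 (λ x y → x := x :- y :+ y) refl x y)
    (trans (+-congʳ x-y≈0) (+-identityˡ y))

  -x≈0⇒x≈0 : ∀ {x} → - x ≈ 0# → x ≈ 0#
  -x≈0⇒x≈0 -x≈0 = trans (sym (-‿involutive _)) (trans (-‿cong -x≈0) -0#≈0#)

  x≈y⇒x-y≈0 : ∀ {x y} → x ≈ y → x - y ≈ 0#
  x≈y⇒x-y≈0 x≈y = trans (+-congʳ x≈y) (-‿inverseʳ _)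

  2≉0 : 2# ≉ 0#
  2≉0 2≈0 = 1≉0 (x+y≈0⇒x≈0 0≤1 0≤1 2≈0)

  x/2+x/2≈x : ∀ x → x / 2# + x / 2# ≈ x
  x/2+x/2≈x x = begin
    x * h + x * h  ≈⟨ solve 2 (λ x h → x :* h :+ x :* h := x :* (con (pos 2) :* h)) refl x h ⟩
    x * (2# * h)   ≈⟨ *-congˡ (*-inverseʳ 2# 2≉0) ⟩
    x * 1#         ≈⟨ *-identityʳ x ⟩
    x              ∎
    where
    open SetoidReasoning setoid
    h = 2# ⁻¹

  -- Halves an inequality without knowing the sign of `2# ⁻¹`: if x ≤ 0, then x = 2x + (-x) is a sum
  -- of nonnegative terms.
  0≤x+x⇒0≤x : ∀ {x} → 0# ≤ x + x → 0# ≤ x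
  0≤x+x⇒0≤x {x} 0≤2x with ≤.total 0# x
  ... | inj₁ 0≤x = 0≤x
  ... | inj₂ x≤0 = ≤.≤-respʳ-≈ (solve 1 (λ x → x :+ x :- x := x) refl x)
    (+-nonNegative 0≤2x (x≤0⇒0≤-x x≤0))

  -- If d = c − (x + y) were positive, then 0 = ac − xy would be d² plus
  -- nonnegative terms.
  c≤a∧xy≈ac⇒c≤x+y : ∀ {a c x y} → 0# ≤ c → c ≤ a → 0# ≤ x → 0# ≤ y →
                     x * y ≈ a * c → c ≤ x + y
  c≤a∧xy≈ac⇒c≤x+y {a} {c} {x} {y} 0≤c c≤a 0≤x 0≤y xy≈ac with ≤.total c (x + y)
  ... | inj₁ c≤x+y = c≤x+y
  ... | inj₂ x+y≤c = ≤.reflexive (x-y≈0⇒x≈y (x²≈0⇒x≈0 d²≈0))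
    where
    d = c - (x + y)
    rest = (a - c) * c + 2# * (d * (x + y)) + (x * x + y * y + x * y)

    0≤rest : 0# ≤ rest
    0≤rest = +-nonNegative
      (+-nonNegative (*-nonNegative (x≤y⇒0≤y-x c≤a) 0≤c)
        (*-nonNegative 0≤2 (*-nonNegative (x≤y⇒0≤y-x x+y≤c) (+-nonNegative 0≤x 0≤y))))
      (+-nonNegative (+-nonNegative (0≤x² x) (0≤x² y)) (*-nonNegative 0≤x 0≤y))

    d²≈0 : d * d ≈ 0#
    d²≈0 = x+y≈0⇒x≈0 (0≤x² d) 0≤rest (trans
      (solve 4 (λ a c x y →
          let d = c :- (x :+ y) in
          d :* d :+ ((a :- c) :* c :+ con (pos 2) :* (d :* (x :+ y))
                     :+ (x :* x :+ y :* y :+ x :* y))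
          := a :* c :- x :* y)
        refl a c x y)
      (x≈y⇒x-y≈0 (sym xy≈ac)))

-- Irreducibility and strong connectivity.

module Irreducibility {c ℓ₁ ℓ₂} (ℝ : CompleteOrderedField c ℓ₁ ℓ₂) where
  open Realizability ℝ
  open OrderedFieldProperties ℝ

  conjugate : ∀ {n} → Permutation′ n → Matrix Carrier n → Matrix Carrier n
  conjugate π A i j = A (π ⟨$⟩ʳ i) (π ⟨$⟩ʳ j)

  conjugate-irreducible : ∀ {n} (π : Permutation′ n) (A : Matrix Carrier n) →
                          Irreducible A → Irreducible (conjugate π A)
  conjugate-irreducible π A irr (ρ , triangular) = irr (ρ ∘ₚ π , triangular)

  Closed : ∀ {n} → Matrix Carrier n → Pred (Fin n) 0ℓ → Set _
  Closed A T = ∀ {i j} → A i j ≉ 0# → T i → T j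

  -- Strong connectivity is phrased by sets closed under outgoing edges, which avoids paths. In a
  -- block triangular form, the vertices placed at positions from `k` on are closed, since the lower
  -- left block vanishes; they form a nonempty set missing the vertex at position 0.
  stronglyConnected⇒irreducible :
    ∀ {n} (A : Matrix Carrier n) →
    (∀ T → Closed A T → ∀ {i j} → T i → T j) → Irreducible A
  stronglyConnected⇒irreducible A connected (π , k , 0<k , k<n , lower≈0) =
    ℕₚ.<⇒≱ 0<k (≡.subst (k ℕ.≤_) toℕ-first (connected T closed last∈T))
    where
    T : Pred _ 0ℓ
    T v = k ℕ.≤ toℕ (π ⟨$⟩ˡ v)

    closed : Closed A T
    closed Aij≉0 i∈T = decidable-stable (k ℕₚ.≤? _) λ j∉T →
      Aij≉0 (≡.subst₂ (λ u v → A u v ≈ 0#) (inverseʳ π) (inverseʳ π)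
        (lower≈0 _ _ i∈T (ℕₚ.≰⇒> j∉T)))

    -- `fromℕ< k<n` is position `k` itself, the first of the second block.
    last∈T : T (π ⟨$⟩ʳ fromℕ< k<n)
    last∈T = ℕₚ.≤-reflexive (≡.sym (≡.trans (≡.cong toℕ (inverseˡ π)) (toℕ-fromℕ< k<n)))

    0<n = ℕₚ.<-trans 0<k k<n

    toℕ-first : toℕ (π ⟨$⟩ˡ (π ⟨$⟩ʳ fromℕ< 0<n)) ≡ 0
    toℕ-first = ≡.trans (≡.cong toℕ (inverseˡ π)) (toℕ-fromℕ< 0<n)

  blockTriangular : (A : Matrix Carrier 4) →
                    (∀ (i j : Fin 2) → A (2 ↑ʳ i) (j ↑ˡ 2) ≈ 0#) → BlockTriangular A
  blockTriangular A lower≈0 = 2 , s≤s z≤n , s≤s (s≤s (s≤s z≤n)) , zeros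
    where
    zeros : ∀ i j → 2 ℕ.≤ toℕ i → toℕ j ℕ.< 2 → A i j ≈ 0#
    zeros 0F _  ()
    zeros 1F _  (s≤s ())
    zeros 2F 0F _ _ = lower≈0 0F 0F
    zeros 2F 1F _ _ = lower≈0 0F 1F
    zeros 3F 0F _ _ = lower≈0 1F 0F
    zeros 3F 1F _ _ = lower≈0 1F 1F
    zeros _  2F _ (s≤s (s≤s ()))
    zeros _  3F _ (s≤s (s≤s ()))

  -- A single nonzero entry from {0,1} to {2,3} forces all entries back to vanish, and `A` is block
  -- triangular as it stands. So all forward entries vanish, and `reverse`, which exchanges the two
  -- blocks, moves them to the lower left.
  noReturn⇒reducible :
    (A : Matrix Carrier 4) →
    (∀ (i j k l : Fin 2) → A (i ↑ˡ 2) (2 ↑ʳ j) ≉ 0# → A (2 ↑ʳ k) (l ↑ˡ 2) ≉ 0# → ⊥) →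
    ¬ Irreducible A
  noReturn⇒reducible A noReturn irr =
    irr (reverse , blockTriangular (conjugate reverse A) upper≈0)
    where
    forward≈0 : ∀ (i j : Fin 2) → A (i ↑ˡ 2) (2 ↑ʳ j) ≈ 0#
    forward≈0 i j = decidable-stable (_ ≤.≟ 0#) λ forward≉0 →
      irr (idₚ , blockTriangular A λ k l → decidable-stable (_ ≤.≟ 0#) λ back≉0 →
        noReturn i j k l forward≉0 back≉0)

    upper≈0 : ∀ (i j : Fin 2) → conjugate reverse A (2 ↑ʳ i) (j ↑ˡ 2) ≈ 0#
    upper≈0 0F 0F = forward≈0 1F 1F
    upper≈0 0F 1F = forward≈0 1F 0F
    upper≈0 1F 0F = forward≈0 0F 1F
    upper≈0 1F 1F = forward≈0 0F 0F

-- The witnesses: characteristic polynomials, nonnegativity, irreducibility.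

module Realisations {c ℓ₁ ℓ₂} (ℝ : CompleteOrderedField c ℓ₁ ℓ₂) where
  open Realizability ℝ
  open IntegerCoefficients commutativeRing
  open OrderedFieldProperties ℝ
  open Irreducibility ℝ
  open Witnesses rawRing public

  quartic-cong : ∀ {k₂ k₃ k₄ l₂ l₃ l₄} → k₂ ≈ l₂ → k₃ ≈ l₃ → k₄ ≈ l₄ →
                 quartic k₂ k₃ k₄ ≈ᵖ quartic l₂ l₃ l₄
  quartic-cong k₂≈l₂ k₃≈l₃ k₄≈l₄ 0 = k₄≈l₄
  quartic-cong k₂≈l₂ k₃≈l₃ k₄≈l₄ 1 = k₃≈l₃
  quartic-cong k₂≈l₂ k₃≈l₃ k₄≈l₄ 2 = k₂≈l₂
  quartic-cong k₂≈l₂ k₃≈l₃ k₄≈l₄ (suc (suc (suc i))) = refl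

  module _ (m r q : Carrier) where
    private
      E = expressions 3
      module W = Witnesses E
      module P = CharPoly E
      p = P.charPoly (W.cyclic (var 0F) (var 1F) (var 2F))

      ρ : Env 3
      ρ = m ∷ r ∷ q ∷ []

    -- The disjoint 2-cycles 01 and 23 together contribute `m * m` to the constant term, and the
    -- 4-cycle contributes `- q`.
    charPoly-cyclic : charPoly (cyclic m r q) ≈ᵖ quartic (- (m + m)) (- r) (m * m - q)
    charPoly-cyclic 0 = prove ρ (P.coeff p 0) (var 0F :* var 0F :- var 2F) refl
    charPoly-cyclic 1 = prove ρ (P.coeff p 1) (:- var 1F) refl
    charPoly-cyclic 2 = prove ρ (P.coeff p 2) (:- (var 0F :+ var 0F)) refl
    charPoly-cyclic 3 = prove ρ (P.coeff p 3) (con (pos 0)) refl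
    charPoly-cyclic 4 = prove ρ (P.coeff p 4) (con (pos 1)) refl
    charPoly-cyclic (suc (suc (suc (suc (suc i))))) = refl

  module _ (r : Carrier) where
    private
      E = expressions 1
      module W = Witnesses E
      module P = CharPoly E
      p = P.charPoly (W.forked (var 0F))

      ρ : Env 1
      ρ = r ∷ []

    charPoly-forked : charPoly (forked r) ≈ᵖ quartic 0# (- (r + r)) 0#
    charPoly-forked 0 = prove ρ (P.coeff p 0) (con (pos 0)) refl
    charPoly-forked 1 = prove ρ (P.coeff p 1) (:- (var 0F :+ var 0F)) refl
    charPoly-forked 2 = prove ρ (P.coeff p 2) (con (pos 0)) refl
    charPoly-forked 3 = prove ρ (P.coeff p 3) (con (pos 0)) refl
    charPoly-forked 4 = prove ρ (P.coeff p 4) (con (pos 1)) refl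
    charPoly-forked (suc (suc (suc (suc (suc i))))) = refl

  cyclic-nonNegative : ∀ {m r q} → 0# ≤ m → 0# ≤ r → 0# ≤ q → NonNegative (cyclic m r q)
  cyclic-nonNegative 0≤m 0≤r 0≤q = λ where
    0F 0F → ≤.refl ; 0F 1F → 0≤1    ; 0F 2F → ≤.refl ; 0F 3F → ≤.refl
    1F 0F → 0≤m    ; 1F 1F → ≤.refl ; 1F 2F → 0≤1    ; 1F 3F → ≤.refl
    2F 0F → 0≤r    ; 2F 1F → ≤.refl ; 2F 2F → ≤.refl ; 2F 3F → 0≤1
    3F 0F → 0≤q    ; 3F 1F → ≤.refl ; 3F 2F → 0≤m    ; 3F 3F → ≤.refl

  forked-nonNegative : ∀ {r} → 0# ≤ r → NonNegative (forked r)
  forked-nonNegative 0≤r = λ where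
    0F 0F → ≤.refl ; 0F 1F → 0≤1    ; 0F 2F → ≤.refl ; 0F 3F → ≤.refl
    1F 0F → ≤.refl ; 1F 1F → ≤.refl ; 1F 2F → 0≤1    ; 1F 3F → 0≤1
    2F 0F → 0≤r    ; 2F 1F → ≤.refl ; 2F 2F → ≤.refl ; 2F 3F → ≤.refl
    3F 0F → 0≤r    ; 3F 1F → ≤.refl ; 3F 2F → ≤.refl ; 3F 3F → ≤.refl

  -- The path 0 → 1 → 2 → 3 is always present, so only a way back from 3 to 0 is missing. It is left
  -- as a hypothesis because it depends on which weights are nonzero.
  cyclic-irreducible : ∀ {m r q} →
    (∀ T → Closed (cyclic m r q) T → T 3F → T 0F) → Irreducible (cyclic m r q)
  cyclic-irreducible {m} {r} {q} return = stronglyConnected⇒irreducible (cyclic m r q)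
    λ T closed {i} {j} → leave T closed j ∘ enter T closed i
    where
    module _ (T : Pred (Fin 4) 0ℓ) (closed : Closed (cyclic m r q) T) where
      0→1 : T 0F → T 1F
      0→1 = closed {0F} {1F} 1≉0

      1→2 : T 1F → T 2F
      1→2 = closed {1F} {2F} 1≉0

      2→3 : T 2F → T 3F
      2→3 = closed {2F} {3F} 1≉0

      enter : ∀ i → T i → T 0F
      enter 0F t = t
      enter 1F t = return T closed (2→3 (1→2 t))
      enter 2F t = return T closed (2→3 t)
      enter 3F t = return T closed t

      leave : ∀ j → T 0F → T j
      leave 0F t = t
      leave 1F t = 0→1 t
      leave 2F t = 1→2 (0→1 t)
      leave 3F t = 2→3 (1→2 (0→1 t))

  forked-irreducible : ∀ {r} → r ≉ 0# → Irreducible (forked r)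
  forked-irreducible {r} r≉0 = stronglyConnected⇒irreducible (forked r)
    λ T closed {i} {j} → leave T closed j ∘ enter T closed i
    where
    module _ (T : Pred (Fin 4) 0ℓ) (closed : Closed (forked r) T) where
      0→1 : T 0F → T 1F
      0→1 = closed {0F} {1F} 1≉0

      enter : ∀ i → T i → T 0F
      enter 0F t = t
      enter 1F t = closed {2F} {0F} r≉0 (closed {1F} {2F} 1≉0 t)
      enter 2F t = closed {2F} {0F} r≉0 t
      enter 3F t = closed {3F} {0F} r≉0 t

      leave : ∀ j → T 0F → T j
      leave 0F t = t
      leave 1F t = 0→1 t
      leave 2F t = closed {1F} {2F} 1≉0 (0→1 t)
      leave 3F t = closed {1F} {3F} 1≉0 (0→1 t)

-- Coefficients as sums of cycle weights.

module CoefficientBounds {c ℓ₁ ℓ₂} (ℝ : CompleteOrderedField c ℓ₁ ℓ₂) where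
  open Realizability ℝ
  open IntegerCoefficients commutativeRing
  open OrderedFieldProperties ℝ
  open Irreducibility ℝ
  open Cycles rawRing

  -- The expansion of the characteristic polynomial over families of disjoint cycles, for zero
  -- diagonal; the sign is the parity of the number of cycles. In this form, relabelling the
  -- vertices only permutes summands.
  record CycleSums (A : Matrix Carrier 4) (k₂ k₃ k₄ : Carrier) : Set ℓ₁ where
    constructor cycleSums
    field
      pairs≈k₂     : - total (pairs A) ≈ k₂
      triangles≈k₃ : - total (triangles A) ≈ k₃
      squares≈k₄   : total (matchings A) - total (squares A) ≈ k₄

  -- Row-major order, so that `var (combine i j)` evaluates to `A i j`.
  entries : Matrix Carrier 4 → Env 16
  entries A = tabulate (uncurry A ∘ remQuot 4)

  -- The diagonal of a realising matrix is zero only up to `≈`. Literal zeros keep it out of the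
  -- identities given to the solver.
  hollow : Matrix Carrier 4 → Matrix Carrier 4
  hollow A i j = if does (i ≟ j) then 0# else A i j

  private
    module P = CharPoly (expressions 16)
    module S = Cycles (expressions 16)

    genericᴱ hollowᴱ : Matrix (Polynomial 16) 4
    genericᴱ i j = var (combine i j)
    hollowᴱ  i j = if does (i ≟ j) then con (pos 0) else genericᴱ i j

  entries-cong : ∀ (A B : Matrix Carrier 4) → (∀ i j → A i j ≈ B i j) →
                 ∀ (e : Polynomial 16) → ⟦ e ⟧ (entries A) ≈ ⟦ e ⟧ (entries B)
  entries-cong A B A≈B e = ⟦⟧-cong e λ k → trans
    (reflexive (lookup∘tabulate (uncurry A ∘ remQuot 4) k))
    (trans (A≈B _ _) (reflexive (≡.sym (lookup∘tabulate (uncurry B ∘ remQuot 4) k))))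

  coeff₃-charPoly : ∀ A → coeff (charPoly A) 3 ≈ - total (diagonal A)
  coeff₃-charPoly A =
    prove (entries A) (P.coeff (P.charPoly genericᴱ) 3) (:- S.total (S.diagonal genericᴱ)) refl

  charPoly-hollow : ∀ A → CycleSums A
    (coeff (charPoly (hollow A)) 2) (coeff (charPoly (hollow A)) 1) (coeff (charPoly (hollow A)) 0)
  charPoly-hollow A = cycleSums
    (prove ρ (:- S.total (S.pairs genericᴱ)) (P.coeff p 2) refl)
    (prove ρ (:- S.total (S.triangles genericᴱ)) (P.coeff p 1) refl)
    (prove ρ (S.total (S.matchings genericᴱ) :- S.total (S.squares genericᴱ)) (P.coeff p 0) refl)
    where
    ρ = entries A
    p = P.charPoly hollowᴱ

  -- The coefficient of x³ is minus the trace and vanishes in `quartic`; nonnegative terms with sum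
  -- zero are all zero.
  diagonal≈0 : ∀ A {k₂ k₃ k₄} → NonNegative A → charPoly A ≈ᵖ quartic k₂ k₃ k₄ →
               All (_≈ 0#) (diagonal A)
  diagonal≈0 A A≥0 A≈P = total≈0⇒all≈0
    (A≥0 0F 0F ∷ A≥0 1F 1F ∷ A≥0 2F 2F ∷ A≥0 3F 3F ∷ [])
    (-x≈0⇒x≈0 (trans (sym (coeff₃-charPoly A)) (A≈P 3)))

  hollow≈ : ∀ A → All (_≈ 0#) (diagonal A) → ∀ i j → hollow A i j ≈ A i j
  hollow≈ A (a₀₀ ∷ a₁₁ ∷ a₂₂ ∷ a₃₃ ∷ []) i j with i ≟ j
  ... | no  _      = refl
  ... | yes ≡.refl = sym (diag i)
    where
    diag : ∀ i → A i i ≈ 0#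
    diag 0F = a₀₀
    diag 1F = a₁₁
    diag 2F = a₂₂
    diag 3F = a₃₃

  -- Since the diagonal vanishes, `hollow A` and `A` agree entrywise, and `toA` carries the
  -- coefficients from one to the other.
  charPoly⇒cycleSums : ∀ A {k₂ k₃ k₄} → NonNegative A → charPoly A ≈ᵖ quartic k₂ k₃ k₄ →
                       CycleSums A k₂ k₃ k₄
  charPoly⇒cycleSums A A≥0 A≈P = cycleSums
    (trans pairs≈k₂ (trans (toA (P.coeff p 2)) (A≈P 2)))
    (trans triangles≈k₃ (trans (toA (P.coeff p 1)) (A≈P 1)))
    (trans squares≈k₄ (trans (toA (P.coeff p 0)) (A≈P 0)))
    where
    open CycleSums (charPoly-hollow A)
    p = P.charPoly genericᴱ

    toA : ∀ e → ⟦ e ⟧ (entries (hollow A)) ≈ ⟦ e ⟧ (entries A)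
    toA = entries-cong (hollow A) A (hollow≈ A (diagonal≈0 A A≥0 A≈P))

  module _ {A : Matrix Carrier 4} (A≥0 : NonNegative A) where

    c₂-nonNegative : ∀ i j → 0# ≤ c₂ A i j
    c₂-nonNegative i j = *-nonNegative (A≥0 i j) (A≥0 j i)

    c₃-nonNegative : ∀ i j k → 0# ≤ c₃ A i j k
    c₃-nonNegative i j k = *-nonNegative (*-nonNegative (A≥0 i j) (A≥0 j k)) (A≥0 k i)

    c₄-nonNegative : ∀ i j k l → 0# ≤ c₄ A i j k l
    c₄-nonNegative i j k l =
      *-nonNegative (*-nonNegative (*-nonNegative (A≥0 i j) (A≥0 j k)) (A≥0 k l)) (A≥0 l i)

    pairs-nonNegative : All (0# ≤_) (pairs A)
    pairs-nonNegative =
      c₂-nonNegative _ _ ∷ c₂-nonNegative _ _ ∷ c₂-nonNegative _ _ ∷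
      c₂-nonNegative _ _ ∷ c₂-nonNegative _ _ ∷ c₂-nonNegative _ _ ∷ []

    triangles-nonNegative : All (0# ≤_) (triangles A)
    triangles-nonNegative =
      c₃-nonNegative _ _ _ ∷ c₃-nonNegative _ _ _ ∷ c₃-nonNegative _ _ _ ∷
      c₃-nonNegative _ _ _ ∷ c₃-nonNegative _ _ _ ∷ c₃-nonNegative _ _ _ ∷
      c₃-nonNegative _ _ _ ∷ c₃-nonNegative _ _ _ ∷ []

  -- Relabelling so that the matching 01, 23 is the heaviest.

  matching₁ matching₂ matching₃ : Matrix Carrier 4 → Carrier
  matching₁ A = c₂ A 0F 1F * c₂ A 2F 3F
  matching₂ A = c₂ A 0F 2F * c₂ A 1F 3F
  matching₃ A = c₂ A 0F 3F * c₂ A 1F 2F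

  Dominant : Matrix Carrier 4 → Set ℓ₂
  Dominant A = matching₂ A ≤ matching₁ A × matching₃ A ≤ matching₁ A

  -- They exchange the matching 01, 23 with 02, 13 and with 03, 12 respectively.
  τ₁₂ τ₁₃ : Permutation′ 4
  τ₁₂ = transpose 1F 2F
  τ₁₃ = transpose 1F 3F

  private
    conjugateᴱ : Permutation′ 4 → Matrix (Polynomial 16) 4
    conjugateᴱ π i j = genericᴱ (π ⟨$⟩ʳ i) (π ⟨$⟩ʳ j)

  cycleSums-τ₁₂ : ∀ A {k₂ k₃ k₄} → CycleSums A k₂ k₃ k₄ → CycleSums (conjugate τ₁₂ A) k₂ k₃ k₄
  cycleSums-τ₁₂ A (cycleSums s₂ s₃ s₄) = cycleSums
    (trans (-‿cong pairs≈) s₂)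
    (trans (-‿cong triangles≈) s₃)
    (trans (+-cong matchings≈ (-‿cong squares≈)) s₄)
    where
    E = conjugateᴱ τ₁₂

    pairs≈ : total (pairs (conjugate τ₁₂ A)) ≈ total (pairs A)
    pairs≈ = prove (entries A) (S.total (S.pairs E)) (S.total (S.pairs genericᴱ)) refl

    triangles≈ : total (triangles (conjugate τ₁₂ A)) ≈ total (triangles A)
    triangles≈ = prove (entries A) (S.total (S.triangles E)) (S.total (S.triangles genericᴱ)) refl

    matchings≈ : total (matchings (conjugate τ₁₂ A)) ≈ total (matchings A)
    matchings≈ = prove (entries A) (S.total (S.matchings E)) (S.total (S.matchings genericᴱ)) refl

    squares≈ : total (squares (conjugate τ₁₂ A)) ≈ total (squares A)
    squares≈ = prove (entries A) (S.total (S.squares E)) (S.total (S.squares genericᴱ)) refl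

  cycleSums-τ₁₃ : ∀ A {k₂ k₃ k₄} → CycleSums A k₂ k₃ k₄ → CycleSums (conjugate τ₁₃ A) k₂ k₃ k₄
  cycleSums-τ₁₃ A (cycleSums s₂ s₃ s₄) = cycleSums
    (trans (-‿cong pairs≈) s₂)
    (trans (-‿cong triangles≈) s₃)
    (trans (+-cong matchings≈ (-‿cong squares≈)) s₄)
    where
    E = conjugateᴱ τ₁₃

    pairs≈ : total (pairs (conjugate τ₁₃ A)) ≈ total (pairs A)
    pairs≈ = prove (entries A) (S.total (S.pairs E)) (S.total (S.pairs genericᴱ)) refl

    triangles≈ : total (triangles (conjugate τ₁₃ A)) ≈ total (triangles A)
    triangles≈ = prove (entries A) (S.total (S.triangles E)) (S.total (S.triangles genericᴱ)) refl

    matchings≈ : total (matchings (conjugate τ₁₃ A)) ≈ total (matchings A)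
    matchings≈ = prove (entries A) (S.total (S.matchings E)) (S.total (S.matchings genericᴱ)) refl

    squares≈ : total (squares (conjugate τ₁₃ A)) ≈ total (squares A)
    squares≈ = prove (entries A) (S.total (S.squares E)) (S.total (S.squares genericᴱ)) refl

  -- Allows `matching₁` to be taken as the largest: relabelling preserves nonnegativity, the cycle
  -- sums and irreducibility.
  dominantConjugate : ∀ {k₂ k₃ k₄} A → NonNegative A → CycleSums A k₂ k₃ k₄ →
    Σ[ B ∈ Matrix Carrier 4 ]
      NonNegative B × CycleSums B k₂ k₃ k₄ × Dominant B × (Irreducible A → Irreducible B)
  dominantConjugate {k₂} {k₃} {k₄} A A≥0 sums =
    choose (≤.total (matching₂ A) (matching₁ A)) (≤.total (matching₃ A) (matching₁ A))
           (≤.total (matching₃ A) (matching₂ A))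
    where
    Result = Σ[ B ∈ Matrix Carrier 4 ]
      NonNegative B × CycleSums B k₂ k₃ k₄ × Dominant B × (Irreducible A → Irreducible B)

    first : Dominant A → Result
    first dominant = A , A≥0 , sums , dominant , λ irr → irr

    second : matching₁ A ≤ matching₂ A → matching₃ A ≤ matching₂ A → Result
    second m₁≤m₂ m₃≤m₂ =
      conjugate τ₁₂ A , (λ i j → A≥0 _ _) , cycleSums-τ₁₂ A sums ,
      -- The third matching is kept, but its 2-cycle 12 is now read as 21.
      (m₁≤m₂ , ≤.≤-respˡ-≈ (*-congˡ (*-comm _ _)) m₃≤m₂) , conjugate-irreducible τ₁₂ A

    third : matching₁ A ≤ matching₃ A → matching₂ A ≤ matching₃ A → Result
    third m₁≤m₃ m₂≤m₃ =
      conjugate τ₁₃ A , (λ i j → A≥0 _ _) , cycleSums-τ₁₃ A sums ,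
      (reorder m₂≤m₃ , reorder m₁≤m₃) , conjugate-irreducible τ₁₃ A
      where
      reorder : ∀ {w x y z u v} → w * (x * y) ≤ z * (u * v) → w * (y * x) ≤ z * (v * u)
      reorder = ≤.≤-respˡ-≈ (*-congˡ (*-comm _ _)) ∘ ≤.≤-respʳ-≈ (*-congˡ (*-comm _ _))

    choose : matching₂ A ≤ matching₁ A ⊎ matching₁ A ≤ matching₂ A →
             matching₃ A ≤ matching₁ A ⊎ matching₁ A ≤ matching₃ A →
             matching₃ A ≤ matching₂ A ⊎ matching₂ A ≤ matching₃ A → Result
    choose (inj₁ m₂≤m₁) (inj₁ m₃≤m₁) _            = first (m₂≤m₁ , m₃≤m₁)
    choose (inj₁ m₂≤m₁) (inj₂ m₁≤m₃) _            = third m₁≤m₃ (≤.trans m₂≤m₁ m₁≤m₃)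
    choose (inj₂ m₁≤m₂) _            (inj₁ m₃≤m₂) = second m₁≤m₂ m₃≤m₂
    choose (inj₂ m₁≤m₂) _            (inj₂ m₂≤m₃) = third (≤.trans m₁≤m₂ m₂≤m₃) m₂≤m₃

  -- The 4-cycles listed are those that pass from {0,1} to {2,3} exactly once.
  crossPairs returnSquares : Matrix Carrier 4 → List Carrier
  crossPairs A    = c₂ A 0F 2F ∷ c₂ A 1F 3F ∷ c₂ A 0F 3F ∷ c₂ A 1F 2F ∷ []
  returnSquares A = c₄ A 0F 2F 3F 1F ∷ c₄ A 1F 3F 2F 0F ∷
                    c₄ A 0F 3F 2F 1F ∷ c₄ A 1F 2F 3F 0F ∷ []

  -- An edge from {0,1} to {2,3} and one back are closed up by at most one edge
  -- inside each block to a cycle.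
  noReturn : ∀ A → c₂ A 0F 1F ≉ 0# → c₂ A 2F 3F ≉ 0# →
    All (_≈ 0#) (crossPairs A) → All (_≈ 0#) (triangles A) → All (_≈ 0#) (returnSquares A) →
    ∀ (i j k l : Fin 2) → A (i ↑ˡ 2) (2 ↑ʳ j) ≉ 0# → A (2 ↑ʳ k) (l ↑ˡ 2) ≉ 0# → ⊥
  noReturn A a≉0 b≉0
    (p₀₂ ∷ p₁₃ ∷ p₀₃ ∷ p₁₂ ∷ [])
    (t₀₂₃ ∷ t₀₃₂ ∷ t₁₂₃ ∷ t₁₃₂ ∷ t₀₂₁ ∷ t₀₃₁ ∷ t₁₂₀ ∷ t₁₃₀ ∷ [])
    (q₀₂₃₁ ∷ q₁₃₂₀ ∷ q₀₃₂₁ ∷ q₁₂₃₀ ∷ []) = λ where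
      0F 0F 0F 0F u v → (u *-≉0 v) p₀₂
      0F 0F 0F 1F u v → (u *-≉0 v *-≉0 a₁₀) t₀₂₁
      0F 0F 1F 0F u v → (u *-≉0 a₂₃ *-≉0 v) t₀₂₃
      0F 0F 1F 1F u v → (u *-≉0 a₂₃ *-≉0 v *-≉0 a₁₀) q₀₂₃₁
      0F 1F 0F 0F u v → (u *-≉0 a₃₂ *-≉0 v) t₀₃₂
      0F 1F 0F 1F u v → (u *-≉0 a₃₂ *-≉0 v *-≉0 a₁₀) q₀₃₂₁
      0F 1F 1F 0F u v → (u *-≉0 v) p₀₃
      0F 1F 1F 1F u v → (u *-≉0 v *-≉0 a₁₀) t₀₃₁
      1F 0F 0F 0F u v → (u *-≉0 v *-≉0 a₀₁) t₁₂₀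
      1F 0F 0F 1F u v → (u *-≉0 v) p₁₂
      1F 0F 1F 0F u v → (u *-≉0 a₂₃ *-≉0 v *-≉0 a₀₁) q₁₂₃₀
      1F 0F 1F 1F u v → (u *-≉0 a₂₃ *-≉0 v) t₁₂₃
      1F 1F 0F 0F u v → (u *-≉0 a₃₂ *-≉0 v *-≉0 a₀₁) q₁₃₂₀
      1F 1F 0F 1F u v → (u *-≉0 a₃₂ *-≉0 v) t₁₃₂
      1F 1F 1F 0F u v → (u *-≉0 v *-≉0 a₀₁) t₁₃₀
      1F 1F 1F 1F u v → (u *-≉0 v) p₁₃
    where
    a₀₁ = xy≉0⇒x≉0 a≉0
    a₁₀ = xy≉0⇒y≉0 a≉0
    a₂₃ = xy≉0⇒x≉0 b≉0
    a₃₂ = xy≉0⇒y≉0 b≉0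

  -- The inequality between k₄ and (k₂/2)².

  module DominantSums {A k₂ k₃ k₄} (A≥0 : NonNegative A)
                      (sums : CycleSums A k₂ k₃ k₄) (dominant : Dominant A) where
    open CycleSums sums

    private
      a = c₂ A 0F 1F
      b = c₂ A 2F 3F
      c′ = c₂ A 0F 2F
      d = c₂ A 1F 3F
      e = c₂ A 0F 3F
      f = c₂ A 1F 2F
      x = c₄ A 0F 2F 3F 1F
      x′ = c₄ A 1F 3F 2F 0F
      y = c₄ A 0F 3F 2F 1F
      y′ = c₄ A 1F 2F 3F 0F
      z = c₄ A 0F 2F 1F 3F
      z′ = c₄ A 0F 3F 1F 2F

    -- Since -k₂ = a + b + r, `excess` is k₂² - (a + b)². Cancelling the matchings shows that
    -- `surplus` is ab - k₄.
    r excess surplus : Carrier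
    r       = total (crossPairs A)
    excess  = r * (2# * (a + b) + r)
    surplus = (x + x′ - c′ * d) + (y + y′ - e * f) + (z + z′)

    -- Substitute k₂² = (a + b)² + `excess` and k₄ = ab - `surplus`, then use (a + b)² - 4ab = (a -
    -- b)². The left side is the discriminant of t² + k₂t + k₄; all three summands on the right turn
    -- out to be nonnegative, so equality makes each vanish.
    discriminant : k₂ * k₂ - 2# * 2# * k₄ ≈ (a - b) * (a - b) + excess + 2# * (2# * surplus)
    discriminant = trans
      (+-cong (*-cong (sym pairs≈k₂) (sym pairs≈k₂)) (-‿cong (*-congˡ (sym squares≈k₄))))
      (solve 12 (λ a b c d e f x x′ y y′ z z′ →
          let r = Σᴱ (c ∷ d ∷ e ∷ f ∷ [])
              k₂ = :- Σᴱ (a ∷ b ∷ c ∷ d ∷ e ∷ f ∷ [])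
              k₄ = Σᴱ (a :* b ∷ c :* d ∷ e :* f ∷ []) :- Σᴱ (x ∷ x′ ∷ y ∷ y′ ∷ z ∷ z′ ∷ [])
              two = con (pos 2)
          in
          k₂ :* k₂ :- two :* two :* k₄
          := (a :- b) :* (a :- b) :+ r :* (two :* (a :+ b) :+ r)
             :+ two :* (two :* ((x :+ x′ :- c :* d) :+ (y :+ y′ :- e :* f) :+ (z :+ z′))))
        refl a b c′ d e f x x′ y y′ z z′)
      where
      open Cycles (expressions 12) using () renaming (total to Σᴱ)

    crossPairs-nonNegative : All (0# ≤_) (crossPairs A)
    crossPairs-nonNegative =
      c₂-nonNegative A≥0 _ _ ∷ c₂-nonNegative A≥0 _ _ ∷
      c₂-nonNegative A≥0 _ _ ∷ c₂-nonNegative A≥0 _ _ ∷ []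

    0≤r : 0# ≤ r
    0≤r = total-nonNegative crossPairs-nonNegative

    0≤a : 0# ≤ a
    0≤a = c₂-nonNegative A≥0 _ _

    0≤b : 0# ≤ b
    0≤b = c₂-nonNegative A≥0 _ _

    0≤2[a+b] : 0# ≤ 2# * (a + b)
    0≤2[a+b] = *-nonNegative 0≤2 (+-nonNegative 0≤a 0≤b)

    0≤excess : 0# ≤ excess
    0≤excess = *-nonNegative 0≤r (+-nonNegative 0≤2[a+b] 0≤r)

    0≤x+x′-cd : 0# ≤ x + x′ - c′ * d
    0≤x+x′-cd = x≤y⇒0≤y-x (c≤a∧xy≈ac⇒c≤x+y
      (*-nonNegative (c₂-nonNegative A≥0 _ _) (c₂-nonNegative A≥0 _ _)) (proj₁ dominant)
      (c₄-nonNegative A≥0 _ _ _ _) (c₄-nonNegative A≥0 _ _ _ _)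
      (prove (entries A) (S.c₄ genericᴱ 0F 2F 3F 1F :* S.c₄ genericᴱ 1F 3F 2F 0F)
        ((S.c₂ genericᴱ 0F 1F :* S.c₂ genericᴱ 2F 3F) :*
         (S.c₂ genericᴱ 0F 2F :* S.c₂ genericᴱ 1F 3F)) refl))

    0≤y+y′-ef : 0# ≤ y + y′ - e * f
    0≤y+y′-ef = x≤y⇒0≤y-x (c≤a∧xy≈ac⇒c≤x+y
      (*-nonNegative (c₂-nonNegative A≥0 _ _) (c₂-nonNegative A≥0 _ _)) (proj₂ dominant)
      (c₄-nonNegative A≥0 _ _ _ _) (c₄-nonNegative A≥0 _ _ _ _)
      (prove (entries A) (S.c₄ genericᴱ 0F 3F 2F 1F :* S.c₄ genericᴱ 1F 2F 3F 0F)
        ((S.c₂ genericᴱ 0F 1F :* S.c₂ genericᴱ 2F 3F) :*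
         (S.c₂ genericᴱ 0F 3F :* S.c₂ genericᴱ 1F 2F)) refl))

    0≤z+z′ : 0# ≤ z + z′
    0≤z+z′ = +-nonNegative (c₄-nonNegative A≥0 _ _ _ _) (c₄-nonNegative A≥0 _ _ _ _)

    0≤surplus : 0# ≤ surplus
    0≤surplus = +-nonNegative (+-nonNegative 0≤x+x′-cd 0≤y+y′-ef) 0≤z+z′

    0≤4surplus : 0# ≤ 2# * (2# * surplus)
    0≤4surplus = *-nonNegative 0≤2 (*-nonNegative 0≤2 0≤surplus)

    0≤discriminant : 0# ≤ k₂ * k₂ - 2# * 2# * k₄
    0≤discriminant = ≤.≤-respʳ-≈ (sym discriminant)
      (+-nonNegative (+-nonNegative (0≤x² _) 0≤excess) 0≤4surplus)

    -- The case of equality.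

    module Equality (k₂≉0 : k₂ ≉ 0#) (k₃≈0 : k₃ ≈ 0#)
                    (disc≈0 : k₂ * k₂ - 2# * 2# * k₄ ≈ 0#) where

      Σ≈0 : (a - b) * (a - b) + excess + 2# * (2# * surplus) ≈ 0#
      Σ≈0 = trans (sym discriminant) disc≈0

      [a-b]²+excess≈0 : (a - b) * (a - b) + excess ≈ 0#
      [a-b]²+excess≈0 = x+y≈0⇒x≈0 (+-nonNegative (0≤x² _) 0≤excess) 0≤4surplus Σ≈0

      a≈b : a ≈ b
      a≈b = x-y≈0⇒x≈y (x²≈0⇒x≈0 (x+y≈0⇒x≈0 (0≤x² _) 0≤excess [a-b]²+excess≈0))

      -- If r were nonzero, the other factor 2(a + b) + r of `excess` would vanish, and with it its
      -- nonnegative summand r.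
      r≈0 : r ≈ 0#
      r≈0 = decidable-stable (r ≤.≟ 0#) λ r≉0 →
        r≉0 (x+y≈0⇒y≈0 0≤2[a+b] 0≤r
          (x≉0∧xy≈0⇒y≈0 r≉0 (x+y≈0⇒y≈0 (0≤x² _) 0≤excess [a-b]²+excess≈0)))

      surplus≈0 : surplus ≈ 0#
      surplus≈0 = x≉0∧xy≈0⇒y≈0 2≉0 (x≉0∧xy≈0⇒y≈0 2≉0
        (x+y≈0⇒y≈0 (+-nonNegative (0≤x² _) 0≤excess) 0≤4surplus Σ≈0))

      k₂≈-[a+b] : k₂ ≈ - (a + b)
      k₂≈-[a+b] = trans (sym pairs≈k₂) (-‿cong (trans (sym (+-assoc _ _ _))
        (trans (+-congˡ r≈0) (+-identityʳ _))))

      -- As r = 0 and a = b, vanishing of a would give k₂ = 0.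
      a≉0 : a ≉ 0#
      a≉0 a≈0 = k₂≉0 (trans k₂≈-[a+b] (trans
        (-‿cong (trans (+-cong a≈0 (trans (sym a≈b) a≈0)) (+-identityʳ _))) -0#≈0#))

      b≉0 : b ≉ 0#
      b≉0 b≈0 = a≉0 (trans a≈b b≈0)

      crossPairs≈0 : All (_≈ 0#) (crossPairs A)
      crossPairs≈0 = total≈0⇒all≈0 crossPairs-nonNegative r≈0

      triangles≈0 : All (_≈ 0#) (triangles A)
      triangles≈0 = total≈0⇒all≈0 (triangles-nonNegative A≥0)
        (-x≈0⇒x≈0 (trans (triangles≈k₃) k₃≈0))

      -- The nonnegative parts of `surplus` vanish, so x + x′ = cd and y + y′ = ef. Both right sides
      -- are zero because c and e are weights of cross pairs.
      returnSquares≈0 : All (_≈ 0#) (returnSquares A)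
      returnSquares≈0 =
        x+y≈0⇒x≈0 0≤x 0≤x′ x+x′≈0 ∷ x+y≈0⇒y≈0 0≤x 0≤x′ x+x′≈0 ∷
        x+y≈0⇒x≈0 0≤y 0≤y′ y+y′≈0 ∷ x+y≈0⇒y≈0 0≤y 0≤y′ y+y′≈0 ∷ []
        where
        0≤x  = c₄-nonNegative A≥0 0F 2F 3F 1F
        0≤x′ = c₄-nonNegative A≥0 1F 3F 2F 0F
        0≤y  = c₄-nonNegative A≥0 0F 3F 2F 1F
        0≤y′ = c₄-nonNegative A≥0 1F 2F 3F 0F

        c≈0 : c′ ≈ 0#
        c≈0 = All.head crossPairs≈0

        e≈0 : e ≈ 0#
        e≈0 = All.head (All.tail (All.tail crossPairs≈0))

        [x+x′-cd]+[y+y′-ef]≈0 : (x + x′ - c′ * d) + (y + y′ - e * f) ≈ 0#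
        [x+x′-cd]+[y+y′-ef]≈0 =
          x+y≈0⇒x≈0 (+-nonNegative 0≤x+x′-cd 0≤y+y′-ef) 0≤z+z′ surplus≈0

        x+x′≈0 : x + x′ ≈ 0#
        x+x′≈0 = trans (x-y≈0⇒x≈y (x+y≈0⇒x≈0 0≤x+x′-cd 0≤y+y′-ef [x+x′-cd]+[y+y′-ef]≈0))
          (trans (*-congʳ c≈0) (zeroˡ _))

        y+y′≈0 : y + y′ ≈ 0#
        y+y′≈0 = trans (x-y≈0⇒x≈y (x+y≈0⇒y≈0 0≤x+x′-cd 0≤y+y′-ef [x+x′-cd]+[y+y′-ef]≈0))
          (trans (*-congʳ e≈0) (zeroˡ _))

      reducible : ¬ Irreducible A
      reducible = noReturn⇒reducible A
        (noReturn A a≉0 b≉0 crossPairs≈0 triangles≈0 returnSquares≈0)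

  cycleSums⇒0≤discriminant : ∀ A {k₂ k₃ k₄} → NonNegative A → CycleSums A k₂ k₃ k₄ →
                             0# ≤ k₂ * k₂ - 2# * 2# * k₄
  cycleSums⇒0≤discriminant A A≥0 sums =
    let _ , B≥0 , sumsB , dominant , _ = dominantConjugate A A≥0 sums
    in DominantSums.0≤discriminant B≥0 sumsB dominant

  discriminant≈0⇒reducible : ∀ A {k₂ k₃ k₄} → NonNegative A → CycleSums A k₂ k₃ k₄ →
    k₂ ≉ 0# → k₃ ≈ 0# → k₂ * k₂ - 2# * 2# * k₄ ≈ 0# → ¬ Irreducible A
  discriminant≈0⇒reducible A A≥0 sums k₂≉0 k₃≈0 disc≈0 irr =
    let _ , B≥0 , sumsB , dominant , irrB = dominantConjugate A A≥0 sums
    in DominantSums.Equality.reducible B≥0 sumsB dominant k₂≉0 k₃≈0 disc≈0 (irrB irr)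

-- Necessary conditions, sufficiency and the exceptional family.

module Realizable⇔IrreduciblyRealizable
  {c ℓ₁ ℓ₂} (ℝ : CompleteOrderedField c ℓ₁ ℓ₂) where
  open Realizability ℝ
  open IntegerCoefficients commutativeRing using (solve; _:+_; _:*_; _:-_; :-_; _:=_; con)
  open OrderedFieldProperties ℝ
  open Irreducibility ℝ
  open Realisations ℝ
  open CoefficientBounds ℝ

  -- Translates between the halved coefficient of the statement and the division-free discriminant.
  4[k²/4-l]≈k²-4l : ∀ k l →
    2# * 2# * ((k / 2#) * (k / 2#) - l) ≈ k * k - 2# * 2# * l
  4[k²/4-l]≈k²-4l k l = trans
    (solve 2 (λ h l → con (pos 2) :* con (pos 2) :* (h :* h :- l)
                   := (h :+ h) :* (h :+ h) :- con (pos 2) :* con (pos 2) :* l)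
      refl (k / 2#) l)
    (+-congʳ (*-cong (x/2+x/2≈x k) (x/2+x/2≈x k)))

  realizable⇒bounds : ∀ {k₂ k₃ k₄} → Realizable 4 (quartic k₂ k₃ k₄) →
    k₂ ≤ 0# × k₃ ≤ 0# × 0# ≤ (k₂ / 2#) * (k₂ / 2#) - k₄
  realizable⇒bounds {k₂} {k₃} {k₄} (A , A≥0 , A≈P) =
    -x≈y⇒y≤0 (total-nonNegative (pairs-nonNegative A≥0)) pairs≈k₂ ,
    -x≈y⇒y≤0 (total-nonNegative (triangles-nonNegative A≥0)) triangles≈k₃ ,
    -- Two halvings remove the factor 4.
    0≤x+x⇒0≤x (0≤x+x⇒0≤x (≤.≤-respʳ-≈ 4q≈2q+2q
      (≤.≤-respʳ-≈ (sym (4[k²/4-l]≈k²-4l k₂ k₄)) (cycleSums⇒0≤discriminant A A≥0 sums))))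
    where
    sums = charPoly⇒cycleSums A A≥0 A≈P
    open CycleSums sums
    q = (k₂ / 2#) * (k₂ / 2#) - k₄

    4q≈2q+2q : 2# * 2# * q ≈ (q + q) + (q + q)
    4q≈2q+2q = solve 1 (λ q → con (pos 2) :* con (pos 2) :* q := (q :+ q) :+ (q :+ q)) refl q

  extremal⇒¬irreduciblyRealizable : ∀ {k₂ k₃ k₄} → k₂ ≉ 0# → k₃ ≈ 0# →
    k₄ ≈ (k₂ / 2#) * (k₂ / 2#) → ¬ IrreduciblyRealizable 4 (quartic k₂ k₃ k₄)
  extremal⇒¬irreduciblyRealizable {k₂} {k₃} {k₄} k₂≉0 k₃≈0 k₄≈k₂²/4 (A , A≥0 , irr , A≈P) =
    discriminant≈0⇒reducible A A≥0 (charPoly⇒cycleSums A A≥0 A≈P) k₂≉0 k₃≈0 disc≈0 irr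
    where
    disc≈0 : k₂ * k₂ - 2# * 2# * k₄ ≈ 0#
    disc≈0 = trans (sym (4[k²/4-l]≈k²-4l k₂ k₄))
      (trans (*-congˡ (x≈y⇒x-y≈0 (sym k₄≈k₂²/4))) (zeroʳ _))

  -- If q ≠ 0, `cyclic` returns along 3 → 0. If q = 0 and k₂ ≠ 0, it returns along 3 → 2 → 0, where
  -- r ≠ 0 because the polynomial is not exceptional. If q = k₂ = 0, then k₄ = 0 and vertex 3 of
  -- `cyclic` has no outgoing edge; `forked` replaces it, with nonzero weight because the polynomial
  -- is not x⁴.
  bounds⇒irreduciblyRealizable : ∀ {k₂ k₃ k₄} → let P = quartic k₂ k₃ k₄ in
    k₂ ≤ 0# → k₃ ≤ 0# → 0# ≤ (k₂ / 2#) * (k₂ / 2#) - k₄ →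
    ¬ (P ≈ᵖ quartic 0# 0# 0#) →
    ¬ (k₂ < 0# × P ≈ᵖ quartic k₂ 0# ((k₂ / 2#) * (k₂ / 2#))) →
    IrreduciblyRealizable 4 P
  bounds⇒irreduciblyRealizable {k₂} {k₃} {k₄} k₂≤0 k₃≤0 0≤q P≉x⁴ unexceptional =
    byCases (q ≤.≟ 0#) (k₂ ≤.≟ 0#)
    where
    h = k₂ / 2#
    m = - h
    r = - k₃
    q = h * h - k₄

    0≤m : 0# ≤ m
    0≤m = 0≤x+x⇒0≤x (≤.≤-respʳ-≈
      (trans (-‿cong (sym (x/2+x/2≈x k₂)))
             (solve 1 (λ h → :- (h :+ h) := (:- h) :+ (:- h)) refl h))
      (x≤0⇒0≤-x k₂≤0))

    cyclic≈P : charPoly (cyclic m r q) ≈ᵖ quartic k₂ k₃ k₄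
    cyclic≈P i = trans (charPoly-cyclic m r q i) (quartic-cong
      (trans (solve 1 (λ h → :- ((:- h) :+ (:- h)) := h :+ h) refl h) (x/2+x/2≈x k₂))
      (solve 1 (λ k → :- (:- k) := k) refl k₃)
      (solve 2 (λ h k → (:- h) :* (:- h) :- (h :* h :- k) := k) refl h k₄) i)

    byCyclic : (∀ T → Closed (cyclic m r q) T → T 3F → T 0F) →
               IrreduciblyRealizable 4 (quartic k₂ k₃ k₄)
    byCyclic return = cyclic m r q ,
      cyclic-nonNegative 0≤m (x≤0⇒0≤-x k₃≤0) 0≤q , cyclic-irreducible return , cyclic≈P

    byCases : Dec (q ≈ 0#) → Dec (k₂ ≈ 0#) → IrreduciblyRealizable 4 (quartic k₂ k₃ k₄)
    byCases (no q≉0) _ = byCyclic λ T closed → closed {3F} {0F} q≉0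
    byCases (yes q≈0) (no k₂≉0) = byCyclic λ T closed →
      closed {2F} {0F} r≉0 ∘ closed {3F} {2F} m≉0
      where
      m≉0 : m ≉ 0#
      m≉0 m≈0 = k₂≉0 (trans (sym (x/2+x/2≈x k₂))
        (trans (+-cong (-x≈0⇒x≈0 m≈0) (-x≈0⇒x≈0 m≈0)) (+-identityʳ _)))

      r≉0 : r ≉ 0#
      r≉0 r≈0 = unexceptional ((k₂≤0 , k₂≉0) ,
        quartic-cong refl (-x≈0⇒x≈0 r≈0) (sym (x-y≈0⇒x≈y q≈0)))
    byCases (yes q≈0) (yes k₂≈0) = forked s , forked-nonNegative 0≤s , forked-irreducible s≉0 ,
      λ i → trans (charPoly-forked s i) (quartic-cong (sym k₂≈0) -[s+s]≈k₃ (sym k₄≈0) i)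
      where
      -- The two 3-cycles of `forked` share the total weight -k₃ equally.
      s = - (k₃ / 2#)

      -[s+s]≈k₃ : - (s + s) ≈ k₃
      -[s+s]≈k₃ = trans (solve 1 (λ h → :- ((:- h) :+ (:- h)) := h :+ h) refl (k₃ / 2#))
        (x/2+x/2≈x k₃)

      0≤s : 0# ≤ s
      0≤s = 0≤x+x⇒0≤x (≤.≤-respʳ-≈
        (trans (-‿cong (sym -[s+s]≈k₃)) (solve 1 (λ s → :- (:- s) := s) refl (s + s)))
        (x≤0⇒0≤-x k₃≤0))

      h≈0 : h ≈ 0#
      h≈0 = trans (*-congʳ k₂≈0) (zeroˡ _)

      k₄≈0 : k₄ ≈ 0#
      k₄≈0 = trans (sym (x-y≈0⇒x≈y q≈0)) (trans (*-congʳ h≈0) (zeroˡ _))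

      s≉0 : s ≉ 0#
      s≉0 s≈0 = P≉x⁴ (quartic-cong k₂≈0 k₃≈0 k₄≈0)
        where
        k₃≈0 : k₃ ≈ 0#
        k₃≈0 = trans (sym -[s+s]≈k₃)
          (trans (-‿cong (trans (+-cong s≈0 s≈0) (+-identityʳ _))) -0#≈0#)

theorem25 : ∀ {c ℓ₁ ℓ₂ : Level} (ℝ : CompleteOrderedField c ℓ₁ ℓ₂) →
    let open Realizability ℝ in
    ∀ (k₂ k₃ k₄ : Carrier) →
    let P = quartic k₂ k₃ k₄
        Exceptional = k₂ < 0# × P ≈ᵖ quartic k₂ 0# ((k₂ / 2#) * (k₂ / 2#))
    in
    ¬ (P ≈ᵖ quartic 0# 0# 0#) →
    (¬ Exceptional → Realizable 4 P ⇔ IrreduciblyRealizable 4 P) ×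
    (Exceptional → ¬ IrreduciblyRealizable 4 P)
theorem25 ℝ k₂ k₃ k₄ P≉x⁴ =
  (λ unexceptional → mk⇔
    (λ realization → let k₂≤0 , k₃≤0 , 0≤q = realizable⇒bounds realization in
      bounds⇒irreduciblyRealizable k₂≤0 k₃≤0 0≤q P≉x⁴ unexceptional)
    (λ (A , A≥0 , _ , A≈P) → A , A≥0 , A≈P)) ,
  -- Coefficients 1 and 0 of the exceptional form give k₃ = 0 and k₄ = (k₂/2)².
  (λ ((_ , k₂≉0) , P≈Q) → extremal⇒¬irreduciblyRealizable k₂≉0 (P≈Q 1) (P≈Q 0))
  where open Realizable⇔IrreduciblyRealizable ℝ
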